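{- $G$ is a connected well-hued graph with sequence $(2,4,6,\dots,2k,2k+1,\dots,n(G))$, where $n(G)\ge 3k$ and $k\ge 2$, if and only if $G$ is obtained from a clique $G_1=K_{n(G)-k}$ and a graph $G_2$ of order $k$ where the following are true: (1) for any $u\in V(G)$, the graph induced by $V(G)-N_G[u]$ is a clique, and (2) for any set of $k$ vertices in $G_1$, say $X_k$, there exists a perfect matching between $X_k$ and $V(G_2)$ in $\overline{G}$.
   Context: All graphs are finite and simple, and $n(G)=|V(G)|$. For $j\ge 1$, a maximal $j$-colorable subgraph of $G$ is a subgraph induced by a set $S\subseteq V(G)$ such that $G[S]$ is (properly) $j$-colorable and $G[S']$ is not $j$-colorable for every $S'$ with $S\subsetneq S'\subseteq V(G)$. $G$ is well-hued if for every $j\ge 1$ all maximal $j$-colorable subgraphs of $G$ have the same order, denoted $a_j$. The sequence of a well-hued graph $G$ is written $(a_1,a_2,\dots,a_{\chi(G)})$, where $\chi(G)$ is the chromatic number and $a_{\chi(G)}=n(G)$. The sequence $(2,4,6,\dots,2k,2k+1,\dots,n(G))$ means $a_i=2i$ for $1\le i\le k$ and $a_i=k+i$ for $k\le i\le n(G)-k$. "$G$ is obtained from $G_1$ and $G_2$" means that $V(G)$ is partitioned into two sets inducing $G_1$ and $G_2$, with edges between the two sets restricted only by (1) and (2). $\overline{G}$ is the complement of $G$, and $N_G[u]$ is the closed neighborhood of $u$. A perfect matching between $X_k$ and $V(G_2)$ in $\overline{G}$ is a set of $k$ pairwise disjoint edges of $\overline{G}$, each joining a vertex of $X_k$ to a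 vertex of $G_2$.
   Formalization: Connectedness of G is assumed for both directions instead of being part of the left side: the disjoint union of K_{n(G)-k} and K_k satisfies (1) and (2) but is disconnected, so connectedness cannot be concluded from them. -}

module Defs where

open import Level using (0ℓ)
open import Data.Nat using (ℕ; _+_; _*_; _∸_; _≤_)
open import Data.Fin using (Fin; _≟_)
open import Data.Fin.Subset using (Subset; _∈_; _⊆_; _⊂_; ∣_∣; ∁)
open import Data.Product using (Σ; ∃; _×_; _,_; proj₁)
open import Data.Vec using (tabulate)
open import Function using (_on_)
open import Relation.Binary using (Rel; Decidable; Symmetric; Irreflexive)
open import Relation.Binary.Construct.Closure.ReflexiveTransitive using (Star)
open import Relation.Binary.PropositionalEquality using (_≡_; _≢_; sym; cong)
open import Relation.Nullary using (¬_; does; ¬?; _×-dec_; _⊎-dec_)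

-- Decidability of adjacency is automatic classically and is what makes
-- a graph on finitely many vertices a finite object here.
record Graph (V : Set) : Set₁ where
  field
    Adj    : Rel V 0ℓ
    adj?   : Decidable Adj
    symm   : Symmetric Adj
    irrefl : Irreflexive _≡_ Adj

open Graph public

infix 8 _[_]

_[_] : ∀ {n} → Graph (Fin n) → (S : Subset n) → Graph (∃ (_∈ S))
G [ S ] = record
  { Adj    = Adj G on proj₁
  ; adj?   = λ u v → adj? G (proj₁ u) (proj₁ v)
  ; symm   = symm G
  ; irrefl = λ u≡v → irrefl G (cong proj₁ u≡v)
  }

complement : ∀ {n} → Graph (Fin n) → Graph (Fin n)
complement G = record
  { Adj    = λ u v → u ≢ v × ¬ Adj G u v
  ; adj?   = λ u v → ¬? (u ≟ v) ×-dec ¬? (adj? G u v)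
  ; symm   = λ (u≢v , ¬uv) → (λ v≡u → u≢v (sym v≡u)) , (λ vu → ¬uv (symm G vu))
  ; irrefl = λ u≡v (u≢v , _) → u≢v u≡v
  }

Complete : ∀ {V} → Graph V → Set
Complete G = ∀ u v → u ≢ v → Adj G u v

Connected : ∀ {V} → Graph V → Set
Connected G = ∀ u v → Star (Adj G) u v

Colorable : ∀ {V} → Graph V → ℕ → Set
Colorable {V} G j = Σ (V → Fin j) λ c → ∀ u v → Adj G u v → c u ≢ c v

IsChromaticNumber : ∀ {V} → Graph V → ℕ → Set
IsChromaticNumber G m = Colorable G m × (∀ j → Colorable G j → m ≤ j)

MaximalColorable : ∀ {n} → Graph (Fin n) → ℕ → Subset n → Set
MaximalColorable G j S =
  Colorable (G [ S ]) j × (∀ S′ → S ⊂ S′ → ¬ Colorable (G [ S′ ]) j)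

WellHued : ∀ {n} → Graph (Fin n) → Set
WellHued G = ∀ j → 1 ≤ j → ∀ S T →
  MaximalColorable G j S → MaximalColorable G j T → ∣ S ∣ ≡ ∣ T ∣

-- a_j = m.  Not vacuous: since the empty subgraph is j-colorable, a
-- maximal j-colorable subgraph always exists.
HueOrder : ∀ {n} → Graph (Fin n) → ℕ → ℕ → Set
HueOrder G j m = ∀ S → MaximalColorable G j S → ∣ S ∣ ≡ m

-- G is well-hued with sequence (2,4,…,2k,2k+1,…,n).  The sequence has
-- χ(G) terms, and its last term k + i = n has index i = n ∸ k.
record WellHuedWithSequence {n} (G : Graph (Fin n)) (k : ℕ) : Set where
  field
    wellHued  : WellHued G
    chromatic : IsChromaticNumber G (n ∸ k)
    initial   : ∀ i → 1 ≤ i → i ≤ k → HueOrder G i (2 * i)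
    final     : ∀ i → k ≤ i → i ≤ n ∸ k → HueOrder G i (k + i)

closedNeighborhood : ∀ {n} → Graph (Fin n) → Fin n → Subset n
closedNeighborhood G u = tabulate λ v → does ((u ≟ v) ⊎-dec adj? G u v)

-- k pairwise disjoint edges of H, each joining a vertex of X to a
-- vertex of Y; it is a perfect matching when ∣ X ∣ ≡ k ≡ ∣ Y ∣.
record Matching {n} (H : Graph (Fin n)) (k : ℕ) (X Y : Subset n) : Set where
  field
    left right : Fin k → Fin n
    left∈X     : ∀ i → left i ∈ X
    right∈Y    : ∀ i → right i ∈ Y
    edge       : ∀ i → Adj H (left i) (right i)
    disjoint   : ∀ i j → i ≢ j →
      left i ≢ left j × left i ≢ right j × right i ≢ left j × right i ≢ right j

-- V₁ and its complement are the vertex sets of G₁ and G₂.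
record ObtainedFromCliqueAndGraph {n} (G : Graph (Fin n)) (k : ℕ) : Set where
  field
    V₁          : Subset n
    order-G₁    : ∣ V₁ ∣ ≡ n ∸ k
    order-G₂    : ∣ ∁ V₁ ∣ ≡ k
    clique-G₁   : Complete (G [ V₁ ])
    nonneighbor : ∀ u → Complete (G [ ∁ (closedNeighborhood G u) ])
    matching    : ∀ X → X ⊆ V₁ → ∣ X ∣ ≡ k → Matching (complement G) k X (∁ V₁)

-- Let H be the complement of G.  Both (1) and a₁ = 2 say that H is triangle-free, so the
-- colour classes of G are single vertices and edges of H: a set S is j-colorable iff it is
-- partitioned into the vertices of a matching M of H and a set R with ∣M∣ + ∣R∣ ≤ j.
--
-- (⇐) The vertices of G₂ cover the edges of H, so matchings of H have at most k edges.  If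
-- ∣M∣ + ∣R∣ = j and S is too small, then ∣M∣ < k and R contains some w; by (2) a k-matching N
-- of H covers M and w, and the path from w in the symmetric difference of M and N augments M
-- and hence enlarges S.
--
-- (⇒) The chromatic number bounds the matchings of H by k edges, and a_k = 2k lets any k
-- vertices be covered by a k-matching of H.  Take a k-matching M, a set X of k vertices
-- missed by M, and a k-matching N covering X.  As M is maximum, X is independent in H, so N
-- joins X to a k-set Q.  An edge of H outside Q would give a matching of k + 1 edges by an
-- exchange in M or in N; hence Q is the vertex set of G₂.

module Submission where

open import Defs
open import Data.Nat using (ℕ; zero; suc; _+_; _*_; _∸_; _⊓_; _≤_; _<_; z≤n; s≤s; s≤s⁻¹; _<?_; pred)
import Data.Nat as ℕ
open import Data.Nat.Properties hiding (_≟_; suc-injective)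
open import Data.Fin using (Fin; zero; suc; toℕ; fromℕ<; _≟_)
open import Data.Fin.Properties using (toℕ<n; toℕ-injective; toℕ-fromℕ<; any?; all?; suc-injective)
import Data.Fin.Subset as Sub
open import Data.Fin.Subset using (Subset; inside; outside; ∣_∣; ∁)
open import Data.Fin.Subset.Properties using (anySubset?; _⊂?_; ∣p∣≤n; ∣∁p∣≡n∸∣p∣; x∈∁p⇒x∉p; x∉p⇒x∈∁p; p⊂q⇒∣p∣<∣q∣)
  renaming (_∈?_ to _∈ₛ?_)
import Data.List as List
open import Data.List using (List; []; _∷_; _++_; length; map; filter; take; allFin)
open import Data.List.Properties using (length-++; ++-identityʳ; length-map; map-∘; length-take; length-filter; length-tabulate)
open import Data.List.Membership.Propositional using (_∈_; _∉_)
open import Data.List.Membership.Propositional.Properties using (∈-++⁺ˡ; ∈-++⁺ʳ; ∈-++⁻; ∈-∃++; ∈-map⁺; ∈-map⁻; ∈-filter⁺; ∈-filter⁻; ∈-allFin; ∈-lookup)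
open import Data.List.Relation.Binary.Permutation.Propositional using (_↭_; refl; prep; swap; trans; ↭-sym; ↭-trans; ↭-refl; ↭⇒↭ₛ; module PermutationReasoning)
open import Data.List.Relation.Binary.Permutation.Propositional.Properties using (↭-length; ∈-resp-↭; All-resp-↭; shift; shifts; ++⁺ˡ; ++⁺ʳ)
import Data.List.Relation.Binary.Permutation.Setoid.Properties as Permutationₛ
open import Data.List.Relation.Binary.Subset.Propositional using (_⊆_)
open import Data.List.Relation.Unary.All as All using (All; []; _∷_)
open import Data.List.Relation.Unary.All.Properties using (¬Any⇒All¬; All¬⇒¬Any) renaming (map⁺ to All-map⁺)
open import Data.List.Relation.Unary.AllPairs using (_∷_; [])
open import Data.List.Relation.Unary.Any using (here; there)
open import Data.List.Relation.Unary.Unique.Propositional using (Unique)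
import Data.List.Relation.Unary.Unique.Propositional.Properties as Unique
open import Data.Product using (Σ; ∃; ∃-syntax; ∃₂; _×_; _,_; proj₁; proj₂)
open import Data.Sum using (inj₁; inj₂; [_,_]′)
open import Data.Vec using (Vec; lookup)
open import Data.Vec.Properties using (lookup∘tabulate; lookup⇒[]=; []=⇒lookup)
open import Data.Vec.Properties.WithK using ([]=-irrelevant)
import Data.Vec as Vec
open import Function using (_∘_; id)
open import Function.Bundles using (_⇔_; mk⇔)
open import Relation.Nullary using (¬_; Dec; does; yes; no; contradiction)
open import Relation.Nullary.Decidable using (map′; dec-true; decidable-stable; _→-dec_; ¬?; _×-dec_; _⊎-dec_)
open import Relation.Unary using (Pred; Decidable)
import Relation.Binary.PropositionalEquality as ≡
open import Relation.Binary.PropositionalEquality using (_≡_; _≢_; refl; sym; cong; subst; setoid)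
open import Level using (0ℓ)

-- Duplicate-free lists up to permutation.

module _ {A : Set} where

  Unique-resp-↭ : {xs ys : List A} → xs ↭ ys → Unique xs → Unique ys
  Unique-resp-↭ p = Permutationₛ.Unique-resp-↭ (setoid A) (↭⇒↭ₛ p)

  unique-∷ : {x : A} {xs : List A} → x ∉ xs → Unique xs → Unique (x ∷ xs)
  unique-∷ x∉xs u = ¬Any⇒All¬ _ x∉xs ∷ u

  head∉tail : {x : A} {xs : List A} → Unique (x ∷ xs) → x ∉ xs
  head∉tail (x≢ ∷ _) = All¬⇒¬Any x≢

  unique-tail : {x : A} {xs : List A} → Unique (x ∷ xs) → Unique xs
  unique-tail (_ ∷ u) = u

  ∈⇒↭ : {x : A} {xs : List A} → x ∈ xs → ∃[ ys ] xs ↭ x ∷ ys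
  ∈⇒↭ {x} x∈xs with as , bs , refl ← ∈-∃++ x∈xs = as ++ bs , shift x as bs

  ∈-tail : {x y : A} {xs : List A} → x ∈ y ∷ xs → x ≢ y → x ∈ xs
  ∈-tail (here x≡y) x≢y = contradiction x≡y x≢y
  ∈-tail (there x∈) _ = x∈

  opaque
    unique-⊆⇒↭ : {xs ys : List A} → Unique xs → xs ⊆ ys → ∃[ zs ] ys ↭ xs ++ zs
    unique-⊆⇒↭ {[]} {ys} _ _ = ys , ↭-refl
    unique-⊆⇒↭ {x ∷ xs} u xs⊆ys
      with ys′ , p ← ∈⇒↭ (xs⊆ys (here refl))
      with zs , q ← unique-⊆⇒↭ {xs} {ys′} (unique-tail u)
             (λ z∈xs → ∈-tail (∈-resp-↭ p (xs⊆ys (there z∈xs)))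
                         (λ { refl → head∉tail u z∈xs }))
      = zs , ↭-trans p (prep x q)

  unique-⊆⇒length≤ : {xs ys : List A} → Unique xs → xs ⊆ ys → length xs ≤ length ys
  unique-⊆⇒length≤ {xs} {ys} u xs⊆ys with zs , p ← unique-⊆⇒↭ u xs⊆ys =
    subst (length xs ≤_) (sym (≡.trans (↭-length p) (length-++ xs))) (m≤m+n _ _)

  unique-⊆-≡⇒↭ : {xs ys : List A} → Unique xs → xs ⊆ ys → length xs ≡ length ys → xs ↭ ys
  unique-⊆-≡⇒↭ {xs} {ys} u xs⊆ys eq with unique-⊆⇒↭ u xs⊆ys
  ... | [] , p = ↭-sym (subst (ys ↭_) (++-identityʳ xs) p)
  ... | z ∷ zs , p = contradiction
    (begin-strict
      length xs                 <⟨ m<m+n (length xs) (s≤s z≤n) ⟩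
      length xs + suc (length zs) ≡⟨ sym (length-++ xs) ⟩
      length (xs ++ z ∷ zs)     ≡⟨ sym (↭-length p) ⟩
      length ys                 ≡⟨ sym eq ⟩
      length xs                 ∎) (<-irrefl refl)
    where open ≤-Reasoning

  unique-++⁻ˡ : (xs : List A) {ys : List A} → Unique (xs ++ ys) → Unique xs
  unique-++⁻ˡ [] u = []
  unique-++⁻ˡ (x ∷ xs) u =
    unique-∷ (head∉tail u ∘ ∈-++⁺ˡ) (unique-++⁻ˡ xs (unique-tail u))

  unique-++⁻ʳ : (xs : List A) {ys : List A} → Unique (xs ++ ys) → Unique ys
  unique-++⁻ʳ [] u = u
  unique-++⁻ʳ (x ∷ xs) u = unique-++⁻ʳ xs (unique-tail u)

  unique-++⇒disjoint : (xs : List A) {ys : List A} {z : A} → Unique (xs ++ ys) → z ∈ xs → z ∉ ys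
  unique-++⇒disjoint (x ∷ xs) u (here refl) z∈ys = head∉tail u (∈-++⁺ʳ xs z∈ys)
  unique-++⇒disjoint (x ∷ xs) u (there z∈xs) = unique-++⇒disjoint xs (unique-tail u) z∈xs

  take⊆ : ∀ m (xs : List A) → take m xs ⊆ xs
  take⊆ (suc m) (x ∷ xs) (here eq) = here eq
  take⊆ (suc m) (x ∷ xs) (there z∈) = there (take⊆ m xs z∈)

  opaque
    -- Used to choose `k`-sets of vertices, either freely (`xs` empty) or around a prescribed set
    -- `xs`. What `ys` has beyond `xs` supplies the missing elements.
    unique-interpolate : ∀ {m} {xs ys : List A} → Unique xs → Unique ys → xs ⊆ ys →
      length xs ≤ m → m ≤ length ys →
      ∃[ zs ] Unique zs × xs ⊆ zs × zs ⊆ ys × length zs ≡ m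
    unique-interpolate {m} {xs} {ys} uxs uys xs⊆ys xs≤m m≤ys
      with rs , p ← unique-⊆⇒↭ uxs xs⊆ys
      = xs ++ take d rs
      , u
      , ∈-++⁺ˡ
      , (λ z∈ → ∈-resp-↭ (↭-sym p) ([ ∈-++⁺ˡ , ∈-++⁺ʳ xs ∘ take⊆ d rs ]′ (∈-++⁻ xs z∈)))
      , eq
      where
      open ≤-Reasoning
      d : ℕ
      d = m ∸ length xs
      u′ : Unique (xs ++ rs)
      u′ = Unique-resp-↭ p uys
      u : Unique (xs ++ take d rs)
      u = Unique.++⁺ uxs (Unique.take⁺ d (unique-++⁻ʳ xs u′))
            (λ (z∈xs , z∈) → unique-++⇒disjoint xs u′ z∈xs (take⊆ d rs z∈))
      d≤ : d ≤ length rs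
      d≤ = m≤n+o⇒m∸n≤o m (length xs)
        (begin m ≤⟨ m≤ys ⟩ length ys ≡⟨ ↭-length p ⟩ length (xs ++ rs) ≡⟨ length-++ xs ⟩ length xs + length rs ∎)
      eq : length (xs ++ take d rs) ≡ m
      eq = begin-equality
        length (xs ++ take d rs) ≡⟨ length-++ xs ⟩
        length xs + length (take d rs) ≡⟨ cong (length xs +_) (length-take d rs) ⟩
        length xs + (d ⊓ length rs) ≡⟨ cong (length xs +_) (m≤n⇒m⊓n≡m d≤) ⟩
        length xs + d ≡⟨ m+[n∸m]≡n xs≤m ⟩
        m ∎

-- Lists of vertex pairs and the vertices they cover.

module _ {V : Set} where

  -- A matching is a list of edges with `Unique (verts M)`, which expresses that the edges are
  -- disjoint.
  verts : List (V × V) → List V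
  verts [] = []
  verts ((a , b) ∷ M) = a ∷ b ∷ verts M

  length-verts : ∀ M → length (verts M) ≡ length M + length M
  length-verts [] = refl
  length-verts (_ ∷ M) = cong suc (≡.trans (cong suc (length-verts M)) (sym (+-suc _ _)))

  verts-resp-↭ : ∀ {M N} → M ↭ N → verts M ↭ verts N
  verts-resp-↭ refl = refl
  verts-resp-↭ (prep (a , b) p) = prep a (prep b (verts-resp-↭ p))
  verts-resp-↭ (swap (a , b) (c , d) p) =
    trans (shifts (a ∷ b ∷ []) (c ∷ d ∷ [])) (++⁺ˡ (c ∷ d ∷ a ∷ b ∷ []) (verts-resp-↭ p))
  verts-resp-↭ (trans p q) = trans (verts-resp-↭ p) (verts-resp-↭ q)

  verts-split : ∀ M → verts M ↭ map proj₁ M ++ map proj₂ M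
  verts-split [] = refl
  verts-split ((a , b) ∷ M) =
    prep a (trans (prep b (verts-split M)) (↭-sym (shift b (map proj₁ M) (map proj₂ M))))

  -- Bracketed so that the number of colour classes, `length M + length R`, is a summand: `j`
  -- classes of which `m` are edges cover `m + j` vertices.
  length-verts-++ : ∀ M (R : List V) → length (verts M ++ R) ≡ length M + (length M + length R)
  length-verts-++ M R = ≡.trans (length-++ (verts M))
    (≡.trans (cong (_+ length R) (length-verts M)) (+-assoc (length M) _ _))

-- Matchings in a graph: orientation, augmenting paths and exchanges.

module ListMatching {n : ℕ} (H : Graph (Fin n)) where

  private
    V = Fin n
    E = Adj H

  open import Data.List.Membership.DecPropositional (_≟_ {n}) using (_∈?_)

  Edges : List (V × V) → Set
  Edges = All (λ (a , b) → E a b)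

  partner : ∀ {w} M → Edges M → w ∈ verts M →
    ∃₂ λ x M′ → E w x × Edges M′ × verts M ↭ w ∷ x ∷ verts M′ × length M ≡ suc (length M′)
  partner ((a , b) ∷ M) (e ∷ es) (here refl) = b , M , e , es , refl , refl
  partner ((a , b) ∷ M) (e ∷ es) (there (here refl)) = a , M , symm H e , es , swap a b refl , refl
  partner {w} ((a , b) ∷ M) (e ∷ es) (there (there w∈)) with partner M es w∈
  ... | x , M′ , wx , es′ , p , eq =
    x , (a , b) ∷ M′ , wx , e ∷ es′
      , trans (prep a (prep b p)) (shifts (a ∷ b ∷ []) (w ∷ x ∷ []))
      , cong suc eq

  partner₂ : ∀ {a b M} → Edges M → (a , b) ∈ M →
    ∃ λ M′ → E a b × Edges M′ × verts M ↭ a ∷ b ∷ verts M′ × length M ≡ suc (length M′)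
  partner₂ es ab∈ with M′ , p ← ∈⇒↭ ab∈ with e ∷ es′ ← All-resp-↭ p es =
    M′ , e , es′ , verts-resp-↭ p , ↭-length p

  opaque
    -- By independence every edge has an end outside `P`; an edge is turned round exactly when its
    -- first end is outside.
    orient : ∀ {P : Pred V 0ℓ} → Decidable P → ∀ M → Edges M →
      (∀ {a b} → (a , b) ∈ M → P a → ¬ P b) →
      ∃ λ M′ → Edges M′ × verts M′ ↭ verts M × length M′ ≡ length M ×
        (∀ {b} → b ∈ map proj₂ M′ → ¬ P b)
    orient P? [] [] _ = [] , [] , refl , refl , λ ()
    orient P? ((a , b) ∷ M) (e ∷ es) indep with orient P? M es (indep ∘ there)
    ... | M′ , es′ , p , eq , ¬P with P? a
    ...   | yes Pa = (a , b) ∷ M′ , e ∷ es′ , prep a (prep b p) , cong suc eq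
                   , λ { (here refl) → indep (here refl) Pa ; (there b∈) → ¬P b∈ }
    ...   | no ¬Pa = (b , a) ∷ M′ , symm H e ∷ es′ , swap b a p , cong suc eq
                   , λ { (here refl) → ¬Pa ; (there b∈) → ¬P b∈ }

  opaque
    -- The alternating path from w takes its first edge w x from N; if M covers x,
    -- say by x y, delete w x from N and x y from M and continue from y.
    augment : ∀ {w} M N → Edges M → Edges N → Unique (verts M) → Unique (verts N) →
      verts M ⊆ verts N → w ∈ verts N → w ∉ verts M →
      ∃₂ λ v M′ → v ∈ verts N × Edges M′ × verts M′ ↭ v ∷ w ∷ verts M × Unique (v ∷ w ∷ verts M)
        × length M′ ≡ suc (length M)
    augment M N = go (length M) M N ≤-refl
      where
      -- `fuel` bounds the number of edges of `M`, which drops by one in each recursive call.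
      go : ∀ {w} fuel M N → length M ≤ fuel → Edges M → Edges N →
        Unique (verts M) → Unique (verts N) →
        verts M ⊆ verts N → w ∈ verts N → w ∉ verts M →
        ∃₂ λ v M′ → v ∈ verts N × Edges M′ × verts M′ ↭ v ∷ w ∷ verts M × Unique (v ∷ w ∷ verts M)
          × length M′ ≡ suc (length M)
      go {w} fuel M N M≤ eM eN uM uN M⊆N w∈N w∉M with partner N eN w∈N
      ... | x , N′ , wx , eN′ , pN , _ with x ∈? verts M | Unique-resp-↭ pN uN
      -- The path ends here, since `M` misses `x`.
      ...   | no x∉M | uN″ =
        x , (w , x) ∷ M , ∈-resp-↭ (↭-sym pN) (there (here refl)) , wx ∷ eM , swap w x refl
          , unique-∷ (λ { (here refl) → irrefl H refl wx ; (there x∈) → x∉M x∈ }) (unique-∷ w∉M uM)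
          , refl
      ...   | yes x∈M | uN″ with partner M eM x∈M
      go {w} zero M N M≤ eM eN uM uN M⊆N w∈N w∉M
          | x , N′ , wx , eN′ , pN , _ | yes x∈M | uN″ | y , M′ , xy , eM′ , pM , lenM =
        contradiction (subst (_≤ 0) lenM M≤) λ ()
      go {w} (suc fuel) M N M≤ eM eN uM uN M⊆N w∈N w∉M
          | x , N′ , wx , eN′ , pN , _ | yes x∈M | uN″ | y , M′ , xy , eM′ , pM , lenM
          with go {y} fuel M′ N′ (s≤s⁻¹ (subst (_≤ suc fuel) lenM M≤)) eM′ eN′
                 (unique-tail (unique-tail uM″)) (unique-tail (unique-tail uN″))
                 (λ z∈ → into (there (there z∈)) λ { refl → head∉tail uM″ (there z∈) })
                 (into (there (here refl)) λ { refl → irrefl H refl xy })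
                 (head∉tail (unique-tail uM″))
        where
        uM″ : Unique (x ∷ y ∷ verts M′)
        uM″ = Unique-resp-↭ pM uM
        -- Deleting `w x` from `N` uncovers only `w`, which `M` misses, and `x`; so `N′` still
        -- covers `y` and `M′`.
        into : ∀ {z} → z ∈ x ∷ y ∷ verts M′ → z ≢ x → z ∈ verts N′
        into {z} z∈ z≢x = ∈-tail (∈-tail (∈-resp-↭ pN (M⊆N z∈M)) (λ { refl → w∉M z∈M })) z≢x
          where
          z∈M : z ∈ verts M
          z∈M = ∈-resp-↭ (↭-sym pM) z∈
      ... | v , M″ , v∈N′ , eM″ , pM″ , u , len =
        v , (w , x) ∷ M″ , v∈N , wx ∷ eM″ , perm
          , unique-∷ v∉ (unique-∷ w∉M uM)
          , cong suc (≡.trans len (sym lenM))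
        where
        v∈N : v ∈ verts N
        v∈N = ∈-resp-↭ (↭-sym pN) (there (there v∈N′))
        -- `M″` covers `v`, `y` and the vertices of `M′`; adding `w` and `x` restores all of `M`.
        perm : w ∷ x ∷ verts M″ ↭ v ∷ w ∷ verts M
        perm = trans (++⁺ˡ (w ∷ x ∷ []) pM″)
                 (trans (shift v (w ∷ x ∷ []) _) (prep v (prep w (↭-sym pM))))
        v∉ : v ∉ w ∷ verts M
        v∉ (here refl) = head∉tail uN″ (there v∈N′)
        v∉ (there v∈M) with ∈-resp-↭ pM v∈M
        ... | here refl = head∉tail (unique-tail uN″) v∈N′
        ... | there v∈ = head∉tail u v∈

  -- Augmentation along a path `u p r w`: the edge `p r`, which `M′` lacks, gives way to `u p` and
  -- `w r`.
  swap-edge : ∀ {p r u w} M {M′} → Edges M′ → Unique (verts M) →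
    verts M ↭ p ∷ r ∷ verts M′ → length M ≡ suc (length M′) →
    E p u → E r w → u ∉ verts M → w ∉ verts M → u ≢ w →
    ∃ λ M″ → Edges M″ × Unique (verts M″) × length M″ ≡ suc (length M)
  swap-edge {p} {r} {u} {w} M {M′} eM′ uM pM len pu rw u∉M w∉M u≢w =
    (u , p) ∷ (w , r) ∷ M′ , symm H pu ∷ symm H rw ∷ eM′
      , Unique-resp-↭ perm
          (unique-∷ (λ { (here u≡w) → u≢w u≡w ; (there u∈M) → u∉M u∈M }) (unique-∷ w∉M uM))
      , cong suc (sym len)
    where
    perm : u ∷ w ∷ verts M ↭ u ∷ p ∷ w ∷ r ∷ verts M′
    perm = prep u (trans (prep w pM) (swap w p refl))

  addEdge : ∀ {u v} {M : List (V × V)} → Unique (verts M) → u ∉ verts M → v ∉ verts M → E u v →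
    Unique (u ∷ v ∷ verts M)
  addEdge uM u∉ v∉ uv =
    unique-∷ (λ { (here refl) → irrefl H refl uv ; (there u∈) → u∉ u∈ }) (unique-∷ v∉ uM)

  ∈-verts₁ : ∀ {a b} {M : List (V × V)} → (a , b) ∈ M → a ∈ verts M
  ∈-verts₁ (here refl) = here refl
  ∈-verts₁ (there ab∈) = there (there (∈-verts₁ ab∈))

  ∈-verts₂ : ∀ {a b} {M : List (V × V)} → (a , b) ∈ M → b ∈ verts M
  ∈-verts₂ (here refl) = there (here refl)
  ∈-verts₂ (there ab∈) = there (there (∈-verts₂ ab∈))

  list⇒matching : ∀ {X Y} N → Edges N → Unique (verts N) →
    (∀ {a b} → (a , b) ∈ N → a Sub.∈ X × b Sub.∈ Y) → Matching H (length N) X Y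
  list⇒matching N es u inXY = record
    { left = proj₁ ∘ List.lookup N
    ; right = proj₂ ∘ List.lookup N
    ; left∈X = λ i → proj₁ (inXY (∈-lookup i))
    ; right∈Y = λ i → proj₂ (inXY (∈-lookup i))
    ; edge = λ i → All.lookup es (∈-lookup i)
    ; disjoint = disjoint N u
    }
    where
    disjoint : ∀ N → Unique (verts N) → ∀ i j → i ≢ j →
      proj₁ (List.lookup N i) ≢ proj₁ (List.lookup N j) ×
      proj₁ (List.lookup N i) ≢ proj₂ (List.lookup N j) ×
      proj₂ (List.lookup N i) ≢ proj₁ (List.lookup N j) ×
      proj₂ (List.lookup N i) ≢ proj₂ (List.lookup N j)
    disjoint (_ ∷ N) u zero zero i≢j = contradiction refl i≢j
    disjoint ((a , b) ∷ N) u zero (suc j) _ =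
      (λ { refl → a∉ (there (∈-verts₁ (∈-lookup j))) }) ,
      (λ { refl → a∉ (there (∈-verts₂ (∈-lookup j))) }) ,
      (λ { refl → b∉ (∈-verts₁ (∈-lookup j)) }) ,
      (λ { refl → b∉ (∈-verts₂ (∈-lookup j)) })
      where
      a∉ = head∉tail u
      b∉ = head∉tail (unique-tail u)
    disjoint (p ∷ N) u (suc i) zero _ with disjoint (p ∷ N) u zero (suc i) (λ ())
    ... | ll , lr , rl , rr = ≡.≢-sym ll , ≡.≢-sym rl , ≡.≢-sym lr , ≡.≢-sym rr
    disjoint (_ ∷ N) u (suc i) (suc j) i≢j =
      disjoint N (unique-tail (unique-tail u)) i j (i≢j ∘ cong suc)

  opaque
    matching⇒list : ∀ {k X Y} → Matching H k X Y → ∃ λ N → Edges N × Unique (verts N) × length N ≡ k ×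
      (∀ {a} → a ∈ map proj₁ N → a Sub.∈ X) × (∀ {b} → b ∈ map proj₂ N → b Sub.∈ Y)
    matching⇒list {k} {X} {Y} m =
      N , All-map⁺ (All.tabulate λ {i} _ → edge i) , unique
        , ≡.trans (length-map pair (allFin k)) (length-tabulate id)
        , firsts , seconds
      where
      open Matching m
      pair : Fin k → V × V
      pair i = left i , right i
      N : List (V × V)
      N = map pair (allFin k)
      firsts : ∀ {a} → a ∈ map proj₁ N → a Sub.∈ X
      firsts a∈ with _ , p∈ , refl ← ∈-map⁻ proj₁ a∈ with _ , _ , refl ← ∈-map⁻ pair p∈ = left∈X _
      seconds : ∀ {b} → b ∈ map proj₂ N → b Sub.∈ Y
      seconds b∈ with _ , p∈ , refl ← ∈-map⁻ proj₂ b∈ with _ , _ , refl ← ∈-map⁻ pair p∈ = right∈Y _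
      injective : ∀ {f : Fin k → V} → (∀ i j → i ≢ j → f i ≢ f j) → ∀ {i j} → f i ≡ f j → i ≡ j
      injective f≢ {i} {j} eq = decidable-stable (i ≟ j) (λ i≢j → f≢ i j i≢j eq)
      -- `disjoint` compares distinct indices only; the two ends of one edge differ because `H` has
      -- no loops.
      left≢right : ∀ i j → left i ≢ right j
      left≢right i j eq with i ≟ j
      ... | yes refl = irrefl H eq (edge i)
      ... | no i≢j = proj₁ (proj₂ (disjoint i j i≢j)) eq
      unique : Unique (verts N)
      unique = Unique-resp-↭ (↭-sym (verts-split N)) (Unique.++⁺
        (subst Unique (map-∘ (allFin k))
          (Unique.map⁺ (injective λ i j i≢j → proj₁ (disjoint i j i≢j)) (Unique.allFin⁺ k)))
        (subst Unique (map-∘ (allFin k))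
          (Unique.map⁺ (injective λ i j i≢j → proj₂ (proj₂ (proj₂ (disjoint i j i≢j)))) (Unique.allFin⁺ k)))
        λ (v∈₁ , v∈₂) → disj v∈₁ v∈₂)
        where
        disj : ∀ {v} → v ∈ map proj₁ N → v ∉ map proj₂ N
        disj v∈₁ v∈₂ with _ , p∈ , refl ← ∈-map⁻ proj₁ v∈₁ | _ , q∈ , eq ← ∈-map⁻ proj₂ v∈₂
          with i , _ , refl ← ∈-map⁻ pair p∈ | j , _ , refl ← ∈-map⁻ pair q∈ = left≢right i j eq

-- Subsets as duplicate-free lists, and functions on subsets.

elems : ∀ {n} → Subset n → List (Fin n)
elems Vec.[] = []
elems (inside Vec.∷ p) = zero ∷ map suc (elems p)
elems (outside Vec.∷ p) = map suc (elems p)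

length-elems : ∀ {n} (p : Subset n) → length (elems p) ≡ ∣ p ∣
length-elems Vec.[] = refl
length-elems (inside Vec.∷ p) = cong suc (≡.trans (length-map suc (elems p)) (length-elems p))
length-elems (outside Vec.∷ p) = ≡.trans (length-map suc (elems p)) (length-elems p)

elems-unique : ∀ {n} (p : Subset n) → Unique (elems p)
elems-unique Vec.[] = []
elems-unique (inside Vec.∷ p) =
  unique-∷ (λ 0∈ → case-⊥ (∈-map⁻ suc 0∈)) (Unique.map⁺ suc-injective (elems-unique p))
  where
  case-⊥ : ¬ (∃ λ x → x ∈ elems p × zero ≡ suc x)
  case-⊥ (_ , _ , ())
elems-unique (outside Vec.∷ p) = Unique.map⁺ suc-injective (elems-unique p)

∈-elems⁺ : ∀ {n} {p : Subset n} {x} → x Sub.∈ p → x ∈ elems p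
∈-elems⁺ {p = inside Vec.∷ p} Vec.here = here refl
∈-elems⁺ {p = inside Vec.∷ p} (Vec.there x∈p) = there (∈-map⁺ suc (∈-elems⁺ x∈p))
∈-elems⁺ {p = outside Vec.∷ p} (Vec.there x∈p) = ∈-map⁺ suc (∈-elems⁺ x∈p)

∈-elems⁻ : ∀ {n} {p : Subset n} {x} → x ∈ elems p → x Sub.∈ p
∈-elems⁻ {p = inside Vec.∷ p} (here refl) = Vec.here
∈-elems⁻ {p = inside Vec.∷ p} (there x∈) with _ , y∈ , refl ← ∈-map⁻ suc x∈ = Vec.there (∈-elems⁻ y∈)
∈-elems⁻ {p = outside Vec.∷ p} x∈ with _ , y∈ , refl ← ∈-map⁻ suc x∈ = Vec.there (∈-elems⁻ y∈)

∃∈-≢ : ∀ {n} {p : Subset n} {x y} {x∈ : x Sub.∈ p} {y∈ : y Sub.∈ p} → (x , x∈) ≢ (y , y∈) → x ≢ y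
∃∈-≢ {x = x} {x∈ = x∈} {y∈} ne refl = ne (cong (x ,_) ([]=-irrelevant x∈ y∈))

module _ {n} {P : Pred (Fin n) 0ℓ} (P? : Decidable P) where

  ∈-tabulate⁺ : ∀ {x} → P x → x Sub.∈ Vec.tabulate (does ∘ P?)
  ∈-tabulate⁺ {x} Px =
    lookup⇒[]= x _ (≡.trans (lookup∘tabulate (does ∘ P?) x) (dec-true (P? x) Px))

  ∈-tabulate⁻ : ∀ {x} → x Sub.∈ Vec.tabulate (does ∘ P?) → P x
  ∈-tabulate⁻ {x} x∈ with P? x | ≡.trans (sym (lookup∘tabulate (does ∘ P?) x)) ([]=⇒lookup x∈)
  ... | yes Px | _ = Px
  ... | no _ | ()

module _ {n : ℕ} where

  open import Data.List.Membership.DecPropositional (_≟_ {n}) using (_∈?_)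

  fromList : List (Fin n) → Subset n
  fromList xs = Vec.tabulate (λ x → does (x ∈? xs))

  ∈-fromList⁺ : ∀ {xs x} → x ∈ xs → x Sub.∈ fromList xs
  ∈-fromList⁺ {xs} = ∈-tabulate⁺ (_∈? xs)

  ∈-fromList⁻ : ∀ {xs x} → x Sub.∈ fromList xs → x ∈ xs
  ∈-fromList⁻ {xs} = ∈-tabulate⁻ (_∈? xs)

  ∣fromList∣ : ∀ {xs} → Unique xs → ∣ fromList xs ∣ ≡ length xs
  ∣fromList∣ {xs} u = ≡.trans (sym (length-elems (fromList xs)))
    (≤-antisym (unique-⊆⇒length≤ {ys = xs} (elems-unique (fromList xs)) (∈-fromList⁻ ∘ ∈-elems⁻))
               (unique-⊆⇒length≤ {ys = elems (fromList xs)} u (∈-elems⁺ ∘ ∈-fromList⁺)))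

-- Colourings are searched as vectors, which can be enumerated entry by entry.
anyVec? : ∀ {j n} {P : Pred (Vec (Fin j) n) 0ℓ} → Decidable P → Dec (∃ P)
anyVec? {n = zero} P? = map′ (λ p → Vec.[] , p) (λ { (Vec.[] , p) → p }) (P? Vec.[])
anyVec? {n = suc n} P? =
  map′ (λ (x , xs , p) → x Vec.∷ xs , p) (λ { (x Vec.∷ xs , p) → x , xs , p })
    (any? λ x → anyVec? λ xs → P? (x Vec.∷ xs))

module _ {n} {A : Set} {S : Subset n} (c : ∃ (Sub._∈ S) → A) (d : A) where

  extend : Fin n → A
  extend v with v ∈ₛ? S
  ... | yes v∈S = c (v , v∈S)
  ... | no _ = d

  -- The membership proof returned is the one that `extend` found, so it need not be compared with
  -- the given one.
  extend-∈ : ∀ {v} → v Sub.∈ S → ∃ λ v∈S → extend v ≡ c (v , v∈S)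
  extend-∈ {v} v∈S with v ∈ₛ? S
  ... | yes v∈S′ = v∈S′ , refl
  ... | no v∉S = contradiction v∈S v∉S

-- Colourings of a graph and matchings of its complement.

module ListColoring {n : ℕ} (G : Graph (Fin n)) where

  private
    V = Fin n
    H = complement G

  open import Data.List.Membership.DecPropositional (_≟_ {n}) using (_∈?_)
  open ListMatching H

  ¬E⇒Adj : ∀ {u v} → u ≢ v → ¬ Adj H u v → Adj G u v
  ¬E⇒Adj {u} {v} u≢v ¬e = decidable-stable (adj? G u v) (λ ¬uv → ¬e (u≢v , ¬uv))

  -- As `c` is total and its values are bounded only on `L`, the same `c` serves every sublist and
  -- every larger `j`, and `j` may be 0.
  ListColorable : ℕ → List V → Set
  ListColorable j L = Σ (V → ℕ) λ c →
    (∀ {v} → v ∈ L → c v < j) × (∀ {u v} → u ∈ L → v ∈ L → Adj G u v → c u ≢ c v)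

  listColorable-⊆ : ∀ {j L L′} → L ⊆ L′ → ListColorable j L′ → ListColorable j L
  listColorable-⊆ L⊆ (c , bound , proper) =
    c , bound ∘ L⊆ , λ u∈ v∈ → proper (L⊆ u∈) (L⊆ v∈)

  listColorable-mono : ∀ {i j L} → i ≤ j → ListColorable i L → ListColorable j L
  listColorable-mono i≤j (c , bound , proper) = c , (λ v∈ → <-≤-trans (bound v∈) i≤j) , proper

  colorable⇒listColorable : ∀ {j S} → Colorable (G [ S ]) j → ListColorable j (elems S)
  colorable⇒listColorable {j} {S} (c , proper) = c′ , bound , proper′
    where
    c′ = extend (toℕ ∘ c) 0
    bound : ∀ {v} → v ∈ elems S → c′ v < j
    bound v∈ with v∈S , eq ← extend-∈ (toℕ ∘ c) 0 (∈-elems⁻ v∈) =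
      subst (_< j) (sym eq) (toℕ<n _)
    proper′ : ∀ {u v} → u ∈ elems S → v ∈ elems S → Adj G u v → c′ u ≢ c′ v
    proper′ u∈ v∈ uv eq
      with u∈S , equ ← extend-∈ (toℕ ∘ c) 0 (∈-elems⁻ u∈)
         | v∈S , eqv ← extend-∈ (toℕ ∘ c) 0 (∈-elems⁻ v∈)
      = proper (_ , u∈S) (_ , v∈S) uv
          (toℕ-injective (≡.trans (sym equ) (≡.trans eq eqv)))

  listColorable⇒colorable : ∀ {j L S} → (∀ {v} → v Sub.∈ S → v ∈ L) →
    ListColorable j L → Colorable (G [ S ]) j
  listColorable⇒colorable S⊆L (c , bound , proper) =
    (λ (v , v∈) → fromℕ< (bound (S⊆L v∈))) ,
    λ (u , u∈) (v , v∈) uv eq → proper (S⊆L u∈) (S⊆L v∈) uv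
      (≡.trans (sym (toℕ-fromℕ< _)) (≡.trans (cong toℕ eq) (toℕ-fromℕ< _)))

  allFin⇒colorable : ∀ {j} → ListColorable j (allFin n) → Colorable G j
  allFin⇒colorable (c , bound , proper) =
    (λ v → fromℕ< (bound (∈-allFin v))) ,
    λ u v uv eq → proper (∈-allFin u) (∈-allFin v) uv
      (≡.trans (sym (toℕ-fromℕ< _)) (≡.trans (cong toℕ eq) (toℕ-fromℕ< _)))

  addColorClass : ∀ {j} K {L} → (∀ {u v} → u ∈ K → v ∈ K → ¬ Adj G u v) →
    ListColorable j L → ListColorable (suc j) (K ++ L)
  addColorClass {j} K {L} indep (c , bound , proper) = c′ , bound′ , proper′
    where
    c′ : V → ℕ
    c′ v with v ∈? K
    ... | yes _ = 0
    ... | no _ = suc (c v)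
    rest : ∀ {v} → v ∈ K ++ L → v ∉ K → v ∈ L
    rest v∈ v∉K = [ (λ v∈K → contradiction v∈K v∉K) , id ]′ (∈-++⁻ K v∈)
    bound′ : ∀ {v} → v ∈ K ++ L → c′ v < suc j
    bound′ {v} v∈ with v ∈? K
    ... | yes _ = s≤s z≤n
    ... | no v∉K = s≤s (bound (rest v∈ v∉K))
    proper′ : ∀ {u v} → u ∈ K ++ L → v ∈ K ++ L → Adj G u v → c′ u ≢ c′ v
    proper′ {u} {v} u∈ v∈ uv eq with u ∈? K | v ∈? K
    ... | yes u∈K | yes v∈K = indep u∈K v∈K uv
    ... | no u∉K | no v∉K = proper (rest u∈ u∉K) (rest v∈ v∉K) uv (cong pred eq)
    proper′ u∈ v∈ uv () | yes _ | no _
    proper′ u∈ v∈ uv () | no _ | yes _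

  -- The colour classes are the edges of `M`, whose ends are nonadjacent in `G`, and the single
  -- vertices of `R`.
  matching⇒listColorable : ∀ M R → Edges M → ListColorable (length M + length R) (verts M ++ R)
  matching⇒listColorable [] [] _ = (λ _ → 0) , (λ ()) , λ ()
  matching⇒listColorable [] (x ∷ R) [] =
    addColorClass (x ∷ []) (λ { (here refl) (here refl) → irrefl G refl })
      (matching⇒listColorable [] R [])
  matching⇒listColorable ((a , b) ∷ M) R ((_ , ¬ab) ∷ es) =
    addColorClass (a ∷ b ∷ [])
      (λ { (here refl) (here refl) → irrefl G refl
         ; (here refl) (there (here refl)) → ¬ab
         ; (there (here refl)) (here refl) → ¬ab ∘ symm G
         ; (there (here refl)) (there (here refl)) → irrefl G refl })
      (matching⇒listColorable M R es)

  decomposition⇒listColorable : ∀ {j L} M R → Edges M → length M + length R ≤ j → L ↭ verts M ++ R →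
    ListColorable j L
  decomposition⇒listColorable M R es le p = listColorable-⊆ (∈-resp-↭ p)
    (listColorable-mono le (matching⇒listColorable M R es))

  TriangleFree : Set
  TriangleFree = ∀ {x y z} → Adj H x y → Adj H x z → ¬ Adj H y z

  opaque
    -- Induction on the number of colours, splitting off the class of the top colour `j`. Its
    -- vertices are pairwise adjacent in `H`, so there are at most two of them: two give an edge of
    -- `M`, one a vertex of `R`.
    listColorable⇒matching : TriangleFree → ∀ j {L} → Unique L → ListColorable j L →
      ∃₂ λ M R → Edges M × L ↭ verts M ++ R × length M + length R ≤ j
    listColorable⇒matching _ zero {[]} _ _ = [] , [] , [] , refl , z≤n
    listColorable⇒matching _ zero {x ∷ L} _ (_ , bound , _) = contradiction (bound (here refl)) λ ()
    listColorable⇒matching tf (suc j) {L} u (c , bound , proper)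
      with B , p ← unique-⊆⇒↭ {xs = filter (λ x → c x ℕ.≟ j) L} (Unique.filter⁺ (λ x → c x ℕ.≟ j) u)
                     (proj₁ ∘ ∈-filter⁻ (λ x → c x ℕ.≟ j) {xs = L})
      with listColorable⇒matching tf j {B} (unique-++⁻ʳ (filter (λ x → c x ℕ.≟ j) L) (Unique-resp-↭ p u))
             ( c
             -- The top colour does not occur in `B`, because its whole class was filtered out.
             , (λ {v} v∈B → ≤∧≢⇒< (s≤s⁻¹ (bound (B⊆L p v∈B)))
                 λ cv≡j → unique-++⇒disjoint (filter (λ x → c x ℕ.≟ j) L) (Unique-resp-↭ p u)
                            (∈-filter⁺ (λ x → c x ℕ.≟ j) (B⊆L p v∈B) cv≡j) v∈B)
             , λ u∈ v∈ → proper (B⊆L p u∈) (B⊆L p v∈))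
      where
      B⊆L : ∀ {A B : List V} → L ↭ A ++ B → B ⊆ L
      B⊆L {A} p x∈ = ∈-resp-↭ (↭-sym p) (∈-++⁺ʳ A x∈)
    ... | M , R , es , q , len = split (filter C? L) p (Unique.filter⁺ C? u) (∈-filter⁻ C? {xs = L})
      where
      C? : Decidable (λ x → c x ≡ j)
      C? x = c x ℕ.≟ j
      split : ∀ A → L ↭ A ++ B → Unique A → (∀ {x} → x ∈ A → x ∈ L × c x ≡ j) →
        ∃₂ λ M R → Edges M × L ↭ verts M ++ R × length M + length R ≤ suc j
      edge : ∀ {A} → (∀ {x} → x ∈ A → x ∈ L × c x ≡ j) → ∀ {x y} → x ∈ A → y ∈ A → x ≢ y → Adj H x y
      edge col x∈ y∈ x≢y = x≢y , λ xy → proper (proj₁ (col x∈)) (proj₁ (col y∈)) xy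
        (≡.trans (proj₂ (col x∈)) (sym (proj₂ (col y∈))))
      -- An empty class wastes a colour; hence the inequality in the conclusion.
      split [] p _ _ = M , R , es , trans p q , m≤n⇒m≤1+n len
      split (x ∷ []) p _ _ = M , x ∷ R , es , trans p (trans (prep x q) (↭-sym (shift x (verts M) R)))
        , subst (_≤ suc j) (sym (+-suc _ _)) (s≤s len)
      split (x ∷ y ∷ []) p ((x≢y ∷ []) ∷ _) col =
        (x , y) ∷ M , R , edge col (here refl) (there (here refl)) x≢y ∷ es
          , trans p (prep x (prep y q)) , s≤s len
      split (x ∷ y ∷ z ∷ _) p ((x≢y ∷ x≢z ∷ _) ∷ (y≢z ∷ _) ∷ _) col =
        contradiction (edge col (there (here refl)) (there (there (here refl))) y≢z)
          (tf (edge col (here refl) (there (here refl)) x≢y)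
              (edge col (here refl) (there (there (here refl))) x≢z))

  -- The form `suc j` supplies `zero` as a default colour outside `S`.
  colorable? : ∀ j S → Dec (Colorable (G [ S ]) (suc j))
  colorable? j S = map′ restrict total
    (anyVec? {P = Proper} λ c → all? λ u → all? λ v → (u ∈ₛ? S) →-dec (v ∈ₛ? S) →-dec
      adj? G u v →-dec ¬? (lookup c u ≟ lookup c v))
    where
    Proper : Vec (Fin (suc j)) n → Set
    Proper c = ∀ u v → u Sub.∈ S → v Sub.∈ S → Adj G u v → lookup c u ≢ lookup c v
    restrict : ∃ Proper → Colorable (G [ S ]) (suc j)
    restrict (c , proper) = (λ (v , _) → lookup c v) , λ (u , u∈) (v , v∈) → proper u v u∈ v∈
    total : Colorable (G [ S ]) (suc j) → ∃ Proper
    total (c , proper) = Vec.tabulate (extend c zero) , λ u v u∈ v∈ uv eq →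
      proper (u , proj₁ (extend-∈ c zero u∈)) (v , proj₁ (extend-∈ c zero v∈)) uv
        (≡.trans (sym (proj₂ (extend-∈ c zero u∈)))
        (≡.trans (sym (lookup∘tabulate _ u))
        (≡.trans eq (≡.trans (lookup∘tabulate _ v) (proj₂ (extend-∈ c zero v∈))))))

  opaque
    -- `S` grows through strictly larger colourable sets while there are any; `fuel` bounds the
    -- number of vertices still outside.
    maximalExtension : ∀ j S → Colorable (G [ S ]) (suc j) →
      ∃ λ S′ → S Sub.⊆ S′ × MaximalColorable G (suc j) S′
    maximalExtension j S = go n S (m≤n+m n ∣ S ∣)
      where
      go : ∀ fuel S → n ≤ ∣ S ∣ + fuel → Colorable (G [ S ]) (suc j) →
        ∃ λ S′ → S Sub.⊆ S′ × MaximalColorable G (suc j) S′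
      go fuel S n≤ col with anySubset? (λ S′ → S ⊂? S′ ×-dec colorable? j S′)
      ... | no ¬∃ = S , id , col , λ S′ S⊂S′ col′ → ¬∃ (S′ , S⊂S′ , col′)
      go zero S n≤ col | yes (S′ , S⊂S′ , _) = contradiction
        (subst (n ≤_) (+-identityʳ _) n≤)
        (<⇒≱ (<-≤-trans (p⊂q⇒∣p∣<∣q∣ S⊂S′) (∣p∣≤n S′)))
      go (suc fuel) S n≤ col | yes (S′ , S⊂S′ , col′)
        with S″ , S′⊆S″ , max ← go fuel S′
               (≤-trans (subst (n ≤_) (+-suc _ _) n≤) (+-monoˡ-≤ fuel (p⊂q⇒∣p∣<∣q∣ S⊂S′))) col′
        = S″ , S′⊆S″ ∘ proj₁ S⊂S′ , max

  opaque
    -- The form in which necessity uses the sequence: a maximal set above `L` has the prescribed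
    -- order.
    extendToHueOrder : ∀ {j m L} → 1 ≤ j → HueOrder G j m → Unique L → ListColorable j L →
      ∃ λ L′ → Unique L′ × L ⊆ L′ × ListColorable j L′ × length L′ ≡ m
    extendToHueOrder {suc j} {m} {L} _ hue u col
      with S′ , S⊆S′ , max ← maximalExtension j (fromList L) (listColorable⇒colorable ∈-fromList⁻ col)
      = elems S′ , elems-unique S′ , ∈-elems⁺ ∘ S⊆S′ ∘ ∈-fromList⁺
      , colorable⇒listColorable (proj₁ max) , ≡.trans (length-elems S′) (hue S′ max)

-- From the clique and the graph of order `k` to the sequence.

module Sufficiency {n k : ℕ} (G : Graph (Fin n)) (3k≤n : 3 * k ≤ n)
  (O : ObtainedFromCliqueAndGraph G k) where

  open ObtainedFromCliqueAndGraph O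

  private
    V = Fin n
    H = complement G
    L₁ = elems V₁
    L₂ = elems (∁ V₁)

  open import Data.List.Membership.DecPropositional (_≟_ {n}) using (_∈?_)
  open ListMatching H
  open ListColoring G

  k+k≤n : k + k ≤ n
  k+k≤n = ≤-trans (+-monoʳ-≤ k (m≤m+n k _)) 3k≤n

  k≤n∸k : k ≤ n ∸ k
  k≤n∸k = m+n≤o⇒m≤o∸n k k+k≤n

  k+[n∸k]≡n : k + (n ∸ k) ≡ n
  k+[n∸k]≡n = m+[n∸m]≡n (≤-trans (m≤m+n k k) k+k≤n)

  length-L₁ : length L₁ ≡ n ∸ k
  length-L₁ = ≡.trans (length-elems V₁) order-G₁

  length-L₂ : length L₂ ≡ k
  length-L₂ = ≡.trans (length-elems (∁ V₁)) order-G₂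

  triangleFree : TriangleFree
  triangleFree {x} {y} {z} xy xz yz =
    proj₂ yz (nonneighbor x (y , outside-N xy) (z , outside-N xz) (proj₁ yz ∘ cong proj₁))
    where
    outside-N : ∀ {v} → Adj H x v → v Sub.∈ ∁ (closedNeighborhood G x)
    outside-N (x≢v , ¬xv) = x∉p⇒x∈∁p λ v∈ →
      [ x≢v , ¬xv ]′ (∈-tabulate⁻ (λ v → (x ≟ v) ⊎-dec adj? G x v) v∈)

  V₁-independent : ∀ {x y} → x Sub.∈ V₁ → y Sub.∈ V₁ → ¬ Adj H x y
  V₁-independent x∈ y∈ (x≢y , ¬xy) = ¬xy (clique-G₁ (_ , x∈) (_ , y∈) (x≢y ∘ cong proj₁))

  opaque
    orientFromV₁ : ∀ M → Edges M →
      ∃ λ M′ → Edges M′ × verts M′ ↭ verts M × length M′ ≡ length M ×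
        (∀ {b} → b ∈ map proj₂ M′ → ¬ b Sub.∈ V₁)
    orientFromV₁ M es = orient (_∈ₛ? V₁) M es
      λ ab∈ a∈ b∈ → V₁-independent a∈ b∈ (All.lookup es ab∈)

  -- `V₁` is independent in `H`, so the edges can be turned to have their second ends in `G₂`; these
  -- are distinct, and `G₂` has `k` vertices.
  matching-≤k : ∀ M → Edges M → Unique (verts M) → length M ≤ k
  matching-≤k M es u with M′ , _ , p , len , out ← orientFromV₁ M es = begin
    length M                 ≡⟨ sym len ⟩
    length M′                ≡⟨ sym (length-map proj₂ M′) ⟩
    length (map proj₂ M′)    ≤⟨ unique-⊆⇒length≤ {ys = L₂}
      (unique-++⁻ʳ (map proj₁ M′) (Unique-resp-↭ (trans (↭-sym p) (verts-split M′)) u))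
      (λ b∈ → ∈-elems⁺ (x∉p⇒x∈∁p (out b∈))) ⟩
    length L₂                ≡⟨ length-L₂ ⟩
    k                        ∎
    where open ≤-Reasoning

  opaque
    -- The matching from (2) has `k` left ends in `X` and `k` right ends in `G₂`, so by counting it
    -- covers both sets.
    matchingOn : ∀ {X} → Unique X → X ⊆ L₁ → length X ≡ k →
      ∃ λ N → Edges N × Unique (verts N) × length N ≡ k × X ⊆ verts N × L₂ ⊆ verts N
    matchingOn {X} uX X⊆ lenX
      with N , es , u , len , left∈ , right∈ ← matching⇒list
             (matching (fromList X) (∈-elems⁻ ∘ X⊆ ∘ ∈-fromList⁻) (≡.trans (∣fromList∣ uX) lenX))
      = N , es , u , len
      , (λ x∈ → ∈-resp-↭ (↭-sym (verts-split N)) (∈-++⁺ˡ (∈-resp-↭ (↭-sym X↭) x∈)))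
      , (λ x∈ → ∈-resp-↭ (↭-sym (verts-split N)) (∈-++⁺ʳ (map proj₁ N) (∈-resp-↭ (↭-sym L₂↭) x∈)))
      where
      u′ : Unique (map proj₁ N ++ map proj₂ N)
      u′ = Unique-resp-↭ (verts-split N) u
      X↭ : map proj₁ N ↭ X
      X↭ = unique-⊆-≡⇒↭ (unique-++⁻ˡ (map proj₁ N) u′) (∈-fromList⁻ ∘ left∈)
             (≡.trans (length-map proj₁ N) (≡.trans len (sym lenX)))
      L₂↭ : map proj₂ N ↭ L₂
      L₂↭ = unique-⊆-≡⇒↭ (unique-++⁻ʳ (map proj₁ N) u′) (∈-elems⁺ ∘ right∈)
             (≡.trans (length-map proj₂ N) (≡.trans len (sym length-L₂)))

  opaque
    -- Each edge of `M` has at most one end in `V₁`. Together with `w` this makes at most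
    -- `length M + 1` vertices to include, and `length M < k` leaves room for them.
    k-setCovering : ∀ {w} M → Edges M → Unique (w ∷ verts M) → length M < k →
      ∃[ X ] Unique X × X ⊆ L₁ × length X ≡ k × (∀ {z} → z ∈ w ∷ verts M → z Sub.∈ V₁ → z ∈ X)
    k-setCovering {w} M es u M<k
      with M′ , _ , p , len , out ← orientFromV₁ M es
      with X , uX , F⊆X , X⊆L₁ , lenX ← unique-interpolate {m = k} {ys = L₁}
        (Unique.filter⁺ (_∈ₛ? V₁)
          (unique-++⁻ˡ (w ∷ map proj₁ M′) {map proj₂ M′}
            (Unique-resp-↭ (prep w (trans (↭-sym p) (verts-split M′))) u)))
        (elems-unique V₁)
        (λ x∈ → ∈-elems⁺ (proj₂ (∈-filter⁻ (_∈ₛ? V₁) {xs = w ∷ map proj₁ M′} x∈)))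
        (≤-trans (length-filter (_∈ₛ? V₁) (w ∷ map proj₁ M′))
          (subst (_< k) (sym (≡.trans (length-map proj₁ M′) len)) M<k))
        (subst (k ≤_) (sym length-L₁) k≤n∸k)
      = X , uX , X⊆L₁ , lenX , λ z∈ z∈V₁ → F⊆X (∈-filter⁺ (_∈ₛ? V₁) (first∈ p out z∈ z∈V₁) z∈V₁)
      where
      first∈ : ∀ {M′} → verts M′ ↭ verts M → (∀ {b} → b ∈ map proj₂ M′ → ¬ b Sub.∈ V₁) →
        ∀ {z} → z ∈ w ∷ verts M → z Sub.∈ V₁ → z ∈ w ∷ map proj₁ M′
      first∈ _ _ (here eq) _ = here eq
      first∈ {M′} p out (there z∈) z∈V₁
        with ∈-++⁻ (map proj₁ M′) (∈-resp-↭ (trans (↭-sym p) (verts-split M′)) z∈)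
      ... | inj₁ z∈₁ = there z∈₁
      ... | inj₂ z∈₂ = contradiction z∈V₁ (out z∈₂)

  opaque
    -- The vertices in `V₁` are put into the set handed to (2); the others lie in `G₂`, which the
    -- resulting matching covers anyway.
    coveringMatching : ∀ {w} M → Edges M → Unique (w ∷ verts M) → length M < k →
      ∃ λ N → Edges N × Unique (verts N) × w ∷ verts M ⊆ verts N
    coveringMatching {w} M es u M<k
      with X , uX , X⊆L₁ , lenX , ∩⊆X ← k-setCovering M es u M<k
      with N , esN , uN , _ , X⊆N , L₂⊆N ← matchingOn uX X⊆L₁ lenX
      = N , esN , uN , covers {X} {N} X⊆N L₂⊆N ∩⊆X
      where
      covers : ∀ {X N} → X ⊆ verts N → L₂ ⊆ verts N →
        (∀ {z} → z ∈ w ∷ verts M → z Sub.∈ V₁ → z ∈ X) → w ∷ verts M ⊆ verts N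
      covers X⊆N L₂⊆N ∩⊆X {z} z∈ with z ∈ₛ? V₁
      ... | yes z∈V₁ = X⊆N (∩⊆X z∈ z∈V₁)
      ... | no z∉V₁ = L₂⊆N (∈-elems⁺ (x∉p⇒x∈∁p z∉V₁))

  fresh : ∀ {L : List V} → length L < n → ∃ λ v → v ∉ L
  fresh {L} L<n with any? (λ v → ¬? (v ∈? L))
  ... | yes v∉ = v∉
  ... | no ¬∃ = contradiction L<n (≤⇒≯ (subst (_≤ length L) (length-tabulate id)
    (unique-⊆⇒length≤ (Unique.allFin⁺ n) λ {v} _ → decidable-stable (v ∈? L) λ v∉ → ¬∃ (v , v∉))))

  opaque
    -- The three strict bounds give, in turn, a vertex outside the set, `length M < k` and
    -- `length M < j`. If a colour is free, the outside vertex becomes a class of its own; otherwise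
    -- `R` is nonempty and `M` is augmented from a vertex `w` of `R`.
    enlarge : ∀ {j} M R → Edges M → Unique (verts M ++ R) → length M + length R ≤ j →
      length (verts M ++ R) < n → length (verts M ++ R) < k + j → length (verts M ++ R) < j + j →
      ∃ λ v → v ∉ verts M ++ R × ListColorable j (v ∷ verts M ++ R)
    enlarge {j} M R es u M+R≤j <n <k+j <j+j with v , v∉ ← fresh {verts M ++ R} <n
      with length M + length R <? j
    ... | yes M+R<j = v , v∉ , decomposition⇒listColorable M (v ∷ R) es
            (subst (_≤ j) (sym (+-suc _ _)) M+R<j) (↭-sym (shift v (verts M) R))
    ... | no M+R≮j = augmented R refl u
      where
      M+R≡j : length M + length R ≡ j
      M+R≡j = ≤-antisym M+R≤j (≮⇒≥ M+R≮j)
      length≡ : length (verts M ++ R) ≡ length M + j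
      length≡ = ≡.trans (length-verts-++ M R) (cong (length M +_) M+R≡j)
      M<k : length M < k
      M<k = +-cancelʳ-< j (length M) k (subst (_< k + j) length≡ <k+j)
      M<j : length M < j
      M<j = +-cancelʳ-< j (length M) j (subst (_< j + j) length≡ <j+j)
      augmented : ∀ R₀ → R ≡ R₀ → Unique (verts M ++ R₀) → ∃ λ v → v ∉ verts M ++ R₀ × ListColorable j (v ∷ verts M ++ R₀)
      augmented [] refl _ = contradiction (≡.trans (sym (+-identityʳ _)) M+R≡j) (<⇒≢ M<j)
      augmented (w ∷ R′) refl u
        with uw ← Unique-resp-↭ (shift w (verts M) R′) u
        with uwM ← unique-++⁻ˡ (w ∷ verts M) uw
        with N , esN , uN , M⊆N ← coveringMatching M es uwM M<k
        with x , M′ , _ , es′ , pM′ , ux , len ← augment M N es esN (unique-tail uwM) uN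
               (M⊆N ∘ there) (M⊆N (here refl)) (head∉tail uwM)
        with x ∈? R′
      -- The far end `x` of the path is the new vertex: the class of `w` is traded for one more
      -- edge.
      ... | no x∉R′ = x , x∉ , decomposition⇒listColorable M′ R′ es′
              (≤-reflexive (≡.trans (cong (_+ length R′) len) (≡.trans (sym (+-suc _ _)) M+R≡j)))
              (trans (prep x (shift w (verts M) R′)) (++⁺ʳ R′ (↭-sym pM′)))
        where
        x∉ : x ∉ verts M ++ w ∷ R′
        x∉ x∈ with ∈-++⁻ (w ∷ verts M) (∈-resp-↭ (shift w (verts M) R′) x∈)
        ... | inj₁ x∈wM = head∉tail ux x∈wM
        ... | inj₂ x∈R′ = x∉R′ x∈R′
      -- Here `x` was a single class as well. One more edge replaces the two classes of `w` and `x`,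
      -- which frees a colour for `v`.
      ... | yes x∈R′ with R″ , pR ← ∈⇒↭ x∈R′ =
        v , v∉ , decomposition⇒listColorable M′ (v ∷ R″) es′ le (↭-sym perm)
        where
        open PermutationReasoning
        perm : verts M′ ++ v ∷ R″ ↭ v ∷ verts M ++ w ∷ R′
        perm = begin
          verts M′ ++ v ∷ R″              ↭⟨ ++⁺ʳ (v ∷ R″) pM′ ⟩
          x ∷ w ∷ verts M ++ v ∷ R″       ↭⟨ shift v (x ∷ w ∷ verts M) R″ ⟩
          v ∷ x ∷ w ∷ verts M ++ R″       ↭⟨ prep v (↭-sym (shift x (w ∷ verts M) R″)) ⟩
          v ∷ w ∷ verts M ++ x ∷ R″       ↭⟨ prep v (++⁺ˡ (w ∷ verts M) (↭-sym pR)) ⟩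
          v ∷ w ∷ verts M ++ R′           ↭⟨ prep v (↭-sym (shift w (verts M) R′)) ⟩
          v ∷ verts M ++ w ∷ R′           ∎
        le : length M′ + length (v ∷ R″) ≤ j
        le = ≤-reflexive (≡.trans (≡.cong₂ _+_ len (sym (↭-length pR)))
               (≡.trans (sym (+-suc _ _)) M+R≡j))

  module _ {j S} (max : MaximalColorable G j S) where

    private
      decomposed = listColorable⇒matching triangleFree j (elems-unique S) (colorable⇒listColorable (proj₁ max))
      M = proj₁ decomposed
      R = proj₁ (proj₂ decomposed)
      es = proj₁ (proj₂ (proj₂ decomposed))
      p = proj₁ (proj₂ (proj₂ (proj₂ decomposed)))
      M+R≤j = proj₂ (proj₂ (proj₂ (proj₂ decomposed)))
      u : Unique (verts M ++ R)
      u = Unique-resp-↭ p (elems-unique S)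

      ∣S∣≡ : ∣ S ∣ ≡ length (verts M ++ R)
      ∣S∣≡ = ≡.trans (sym (length-elems S)) (↭-length p)

      ∣S∣≤ : ∀ {m} → length M ≤ m → ∣ S ∣ ≤ m + j
      ∣S∣≤ M≤m = subst (_≤ _) (sym (≡.trans ∣S∣≡ (length-verts-++ M R))) (+-mono-≤ M≤m M+R≤j)

    maximal-≤2j : ∣ S ∣ ≤ j + j
    maximal-≤2j = ∣S∣≤ (≤-trans (m≤m+n (length M) _) M+R≤j)

    maximal-≤k+j : ∣ S ∣ ≤ k + j
    maximal-≤k+j = ∣S∣≤ (matching-≤k M es (unique-++⁻ˡ (verts M) u))

    -- With the upper bounds `n`, `k + j` and `j + j` this makes `∣ S ∣` the least of the three; the
    -- ranges of `j` below differ in which one is least.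
    maximal-large : ∣ S ∣ < n → ∣ S ∣ < k + j → ¬ ∣ S ∣ < j + j
    maximal-large <n <k+j <j+j
      with v , v∉ , col ← enlarge M R es u M+R≤j
             (subst (_< n) ∣S∣≡ <n) (subst (_< k + j) ∣S∣≡ <k+j) (subst (_< j + j) ∣S∣≡ <j+j)
      = proj₂ max (fromList (v ∷ verts M ++ R))
          ( (λ x∈S → ∈-fromList⁺ {xs = v ∷ verts M ++ R} (there (∈-resp-↭ p (∈-elems⁺ x∈S))))
          , v , ∈-fromList⁺ {xs = v ∷ verts M ++ R} (here refl) , λ v∈S → v∉ (∈-resp-↭ p (∈-elems⁺ v∈S)))
          (listColorable⇒colorable (∈-fromList⁻ {xs = v ∷ verts M ++ R}) col)

  initialOrder : ∀ i → i ≤ k → HueOrder G i (2 * i)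
  initialOrder i i≤k S max = ≡.trans
    (≤-antisym (maximal-≤2j max) (≮⇒≥ λ S<2i → maximal-large max
      (<-≤-trans S<2i (≤-trans (+-mono-≤ i≤k i≤k) k+k≤n))
      (<-≤-trans S<2i (+-monoˡ-≤ i i≤k)) S<2i))
    (cong (i +_) (sym (+-identityʳ i)))

  finalOrder : ∀ i → k ≤ i → i ≤ n ∸ k → HueOrder G i (k + i)
  finalOrder i k≤i i≤ S max = ≤-antisym (maximal-≤k+j max) (≮⇒≥ λ S<k+i → maximal-large max
    (<-≤-trans S<k+i (subst (k + i ≤_) k+[n∸k]≡n (+-monoʳ-≤ k i≤)))
    S<k+i (<-≤-trans S<k+i (+-monoˡ-≤ i k≤i)))

  -- `WellHued` also speaks of `j` beyond the end of the sequence, where a maximal set contains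
  -- every vertex.
  fullOrder : ∀ i → n ∸ k ≤ i → HueOrder G i n
  fullOrder i n∸k≤i S max = ≤-antisym (∣p∣≤n S) (≮⇒≥ λ S<n → maximal-large max S<n
    (<-≤-trans S<n n≤k+i)
    (<-≤-trans S<n (≤-trans n≤k+i (+-monoˡ-≤ i (≤-trans k≤n∸k n∸k≤i)))))
    where
    n≤k+i : n ≤ k + i
    n≤k+i = subst (_≤ k + i) k+[n∸k]≡n (+-monoʳ-≤ k n∸k≤i)

  wellHued : WellHued G
  wellHued j _ S T maxS maxT with ≤-total j k | ≤-total j (n ∸ k)
  ... | inj₁ j≤k | _ = ≡.trans (initialOrder j j≤k S maxS) (sym (initialOrder j j≤k T maxT))
  ... | inj₂ k≤j | inj₁ j≤ = ≡.trans (finalOrder j k≤j j≤ S maxS) (sym (finalOrder j k≤j j≤ T maxT))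
  ... | inj₂ _ | inj₂ ≤j = ≡.trans (fullOrder j ≤j S maxS) (sym (fullOrder j ≤j T maxT))

  -- The edges of a `k`-matching and the `n - 2k` other vertices make `n - k` classes.
  colorable-n∸k : Colorable G (n ∸ k)
  colorable-n∸k
    with X , uX , _ , X⊆ , lenX ← unique-interpolate {m = k} {xs = []} [] (elems-unique V₁) (λ ()) z≤n
           (subst (k ≤_) (sym length-L₁) k≤n∸k)
    with N , es , u , refl , _ ← matchingOn uX X⊆ lenX
    with R , p ← unique-⊆⇒↭ u (λ {v} _ → ∈-allFin v)
    = allFin⇒colorable (decomposition⇒listColorable N R es (≤-reflexive eq) p)
    where
    open ≡.≡-Reasoning
    eq : k + length R ≡ n ∸ k
    eq = begin
      k + length R                   ≡⟨ sym (m+n∸m≡n k _) ⟩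
      k + (k + length R) ∸ k         ≡⟨ cong (_∸ k) (sym (length-verts-++ N R)) ⟩
      length (verts N ++ R) ∸ k      ≡⟨ cong (_∸ k) (sym (↭-length p)) ⟩
      length (allFin n) ∸ k          ≡⟨ cong (_∸ k) (length-tabulate id) ⟩
      n ∸ k                          ∎

  -- No edge of `H` lies in `V₁`, so each of its `n - k` vertices takes a colour of its own.
  n∸k≤χ : ∀ j → Colorable G j → n ∸ k ≤ j
  n∸k≤χ j (c , proper)
    with listColorable⇒matching triangleFree j (elems-unique V₁)
           (colorable⇒listColorable {S = V₁} (c ∘ proj₁ , λ u v → proper (proj₁ u) (proj₁ v)))
  ... | [] , R , _ , p , le = subst (_≤ j) (≡.trans (sym (↭-length p)) length-L₁) le
  ... | (a , b) ∷ M , R , ab ∷ _ , p , _ = contradiction ab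
    (V₁-independent (∈-elems⁻ (∈-resp-↭ (↭-sym p) (here refl)))
                    (∈-elems⁻ (∈-resp-↭ (↭-sym p) (there (here refl)))))

  conclusion : WellHuedWithSequence G k
  conclusion = record
    { wellHued = wellHued
    ; chromatic = colorable-n∸k , n∸k≤χ
    ; initial = λ i _ → initialOrder i
    ; final = finalOrder
    }

-- From the sequence to the clique and the graph of order `k`.

module Necessity {n k : ℕ} (G : Graph (Fin n)) (2≤k : 2 ≤ k) (3k≤n : 3 * k ≤ n)
  (W : WellHuedWithSequence G k) where

  open WellHuedWithSequence W

  private
    V = Fin n
    H = complement G

  open import Data.List.Membership.DecPropositional (_≟_ {n}) using (_∈?_)
  open ListMatching H
  open ListColoring G

  k≤n : k ≤ n
  k≤n = ≤-trans (m≤m+n k _) 3k≤n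

  -- A triangle of `H` would be a 1-colorable set of three vertices, too many for `a₁ = 2`.
  triangleFree : TriangleFree
  triangleFree {x} {y} {z} xy xz yz
    = contradiction 3≤2 λ { (s≤s (s≤s ())) }
    where
    unique : Unique (x ∷ y ∷ z ∷ [])
    unique = (proj₁ xy ∷ proj₁ xz ∷ []) ∷ (proj₁ yz ∷ []) ∷ [] ∷ []
    colorable : ListColorable 1 (x ∷ y ∷ z ∷ [])
    colorable = addColorClass {0} (x ∷ y ∷ z ∷ []) {[]}
      (λ { (here refl) (here refl) → irrefl G refl
         ; (here refl) (there (here refl)) → proj₂ xy
         ; (here refl) (there (there (here refl))) → proj₂ xz
         ; (there (here refl)) (here refl) → proj₂ xy ∘ symm G
         ; (there (here refl)) (there (here refl)) → irrefl G refl
         ; (there (here refl)) (there (there (here refl))) → proj₂ yz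
         ; (there (there (here refl))) (here refl) → proj₂ xz ∘ symm G
         ; (there (there (here refl))) (there (here refl)) → proj₂ yz ∘ symm G
         ; (there (there (here refl))) (there (there (here refl))) → irrefl G refl })
      ((λ _ → 0) , (λ ()) , λ ())
    3≤2 : 3 ≤ 2
    3≤2 with L , _ , ⊆L , _ , len ← extendToHueOrder ≤-refl (initial 1 ≤-refl (≤-trans (s≤s z≤n) 2≤k))
               unique colorable
      = subst (3 ≤_) len (unique-⊆⇒length≤ {ys = L} unique ⊆L)

  opaque
    -- With a colour for each vertex, `X` is `k`-colorable, so it lies in a `k`-colorable set of
    -- order `2 * k`, all of whose classes must be edges.
    matchingCovering : ∀ {X} → Unique X → length X ≡ k →
      ∃ λ M → Edges M × Unique (verts M) × length M ≡ k × X ⊆ verts M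
    matchingCovering {X} uX lenX
      with L , uL , X⊆L , col , len ← extendToHueOrder (≤-trans (s≤s z≤n) 2≤k) (initial k (≤-trans (s≤s z≤n) 2≤k) ≤-refl) uX
             (subst (λ m → ListColorable m X) lenX (matching⇒listColorable [] X []))
      with M , R , es , p , le ← listColorable⇒matching triangleFree k uL col
      = M , es , unique-++⁻ˡ (verts M) (Unique-resp-↭ p uL)
      , M≡k (length M) (length R) (≡.trans (sym len) (≡.trans (↭-length p) (length-verts-++ M R))) le
      , λ x∈X → covered R (R≡0 (length M) (length R) (≡.trans (sym len) (≡.trans (↭-length p) (length-verts-++ M R))) le)
                  (∈-resp-↭ p (X⊆L x∈X))
      where
      -- At most `k` classes, `m` pairs and `r` single vertices, contain `2 * k` vertices only if
      -- `m` is `k` and `r` is 0.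
      module _ m r (eq : 2 * k ≡ m + (m + r)) (le : m + r ≤ k) where
        M≡k : m ≡ k
        M≡k = ≤-antisym (≤-trans (m≤m+n m r) le)
          (+-cancelʳ-≤ k k m (begin
            k + k           ≡⟨ cong (k +_) (sym (+-identityʳ k)) ⟩
            2 * k           ≡⟨ eq ⟩
            m + (m + r)     ≤⟨ +-monoʳ-≤ m le ⟩
            m + k           ∎))
          where open ≤-Reasoning
        R≡0 : r ≡ 0
        R≡0 = n≤0⇒n≡0 (+-cancelˡ-≤ m r 0
          (subst (m + r ≤_) (≡.trans (sym M≡k) (sym (+-identityʳ m))) le))
      covered : ∀ {M} (R : List V) → length R ≡ 0 → ∀ {x} → x ∈ verts M ++ R → x ∈ verts M
      covered {M} [] _ = subst (_ ∈_) (++-identityʳ (verts M))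

  complementList : ∀ {L : List V} → Unique L → ∃[ R ] allFin n ↭ L ++ R
  complementList u = unique-⊆⇒↭ u (λ {v} _ → ∈-allFin v)

  -- Colouring the two ends of each edge alike and all other vertices separately takes
  -- `n ∸ length M` colours, which is at least the chromatic number `n ∸ k`.
  matching-≤k : ∀ M → Edges M → Unique (verts M) → length M ≤ k
  matching-≤k M es u with R , p ← complementList u =
    +-cancelʳ-≤ (length M + length R) (length M) k (begin
      length M + (length M + length R)  ≡⟨ sym (length-verts-++ M R) ⟩
      length (verts M ++ R)             ≡⟨ sym (↭-length p) ⟩
      length (allFin n)                 ≡⟨ length-tabulate id ⟩
      n                                 ≡⟨ sym (m+[n∸m]≡n k≤n) ⟩
      k + (n ∸ k)                       ≤⟨ +-monoʳ-≤ k (proj₂ chromatic _ (allFin⇒colorable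
        (decomposition⇒listColorable M R es ≤-refl p))) ⟩
      k + (length M + length R)         ∎)
    where open ≤-Reasoning

  maximum : ∀ (M : List (V × V)) → length M ≡ k → ¬ (∃ λ M′ → Edges M′ × Unique (verts M′) × length M′ ≡ suc (length M))
  maximum M len (M′ , es , u , len′) =
    <-irrefl refl (subst (_≤ k) (≡.trans len′ (cong suc len)) (matching-≤k M′ es u))

  maximum⇒maximal : ∀ {M u v} → Edges M → Unique (verts M) → length M ≡ k →
    u ∉ verts M → v ∉ verts M → ¬ Adj H u v
  maximum⇒maximal {M} {u} {v} es uM len u∉ v∉ uv =
    maximum M len ((u , v) ∷ M , uv ∷ es , addEdge uM u∉ v∉ uv , refl)

  opaque
    -- Once the second ends avoid `P`, the vertices of `X` can only be first ends, and being `k` in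
    -- number they are all of them. Used first with membership in `X` as `P`, later with membership
    -- in `V₁`.
    matchingFrom : ∀ {P : Pred V 0ℓ} → Decidable P → (∀ {a b} → P a → P b → ¬ Adj H a b) →
      ∀ {X} → Unique X → length X ≡ k → (∀ {x} → x ∈ X → P x) →
      ∃ λ N → Edges N × Unique (verts N) × length N ≡ k × map proj₁ N ↭ X ×
        (∀ {b} → b ∈ map proj₂ N → ¬ P b)
    matchingFrom {P} P? indep {X} uX lenX X⊆P
      with M , es , u , len , X⊆M ← matchingCovering uX lenX
      with N , esN , p , lenN , out ← orient P? M es (λ ab∈ Pa Pb → indep Pa Pb (All.lookup es ab∈))
      = N , esN , Unique-resp-↭ (↭-sym p) u , ≡.trans lenN len
      , ↭-sym (unique-⊆-≡⇒↭ uX (first∈ p X⊆M out)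
          (≡.trans lenX (sym (≡.trans (length-map proj₁ N) (≡.trans lenN len)))))
      , out
      where
      first∈ : ∀ {M N} → verts N ↭ verts M → X ⊆ verts M → (∀ {b} → b ∈ map proj₂ N → ¬ P b) →
        X ⊆ map proj₁ N
      first∈ {N = N} p X⊆M out x∈X =
        [ id , (λ x∈ → contradiction (X⊆P x∈X) (out x∈)) ]′
          (∈-++⁻ (map proj₁ N) (∈-resp-↭ (trans (↭-sym p) (verts-split N)) (X⊆M x∈X)))

  k≤uncovered : ∀ M {R : List V} → allFin n ↭ verts M ++ R → length M ≡ k → k ≤ length R
  k≤uncovered M {R} p lenM = +-cancelˡ-≤ (k + k) k (length R) (begin
    k + k + k                    ≡⟨ +-assoc k k k ⟩
    k + (k + k)                  ≡⟨ cong (λ m → k + (k + m)) (sym (+-identityʳ k)) ⟩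
    3 * k                        ≤⟨ 3k≤n ⟩
    n                            ≡⟨ sym (length-tabulate id) ⟩
    length (allFin n)            ≡⟨ ↭-length p ⟩
    length (verts M ++ R)        ≡⟨ length-verts-++ M R ⟩
    length M + (length M + length R) ≡⟨ cong (λ m → m + (m + length R)) lenM ⟩
    k + (k + length R)           ≡⟨ sym (+-assoc k k _) ⟩
    k + k + length R             ∎)
    where open ≤-Reasoning

  opaque
    uncoveredSet : ∀ M → Unique (verts M) → length M ≡ k →
      ∃ λ (X : List V) → Unique X × (∀ {x} → x ∈ X → x ∉ verts M) × length X ≡ k
    uncoveredSet M uM lenM
      with R , p ← complementList uM
      with X , uX , _ , X⊆R , lenX ← unique-interpolate {m = k} {xs = []} []
             (unique-++⁻ʳ (verts M) (Unique-resp-↭ p (Unique.allFin⁺ n))) (λ ()) z≤n (k≤uncovered M p lenM)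
      = X , uX
      , (λ x∈X x∈M → unique-++⇒disjoint (verts M) (Unique-resp-↭ p (Unique.allFin⁺ n)) x∈M (X⊆R x∈X))
      , lenX

  -- M is any maximum matching and X a k-set missed by M, matched by N to the vertex set of G₂.
  record Configuration : Set where
    field
      M N      : List (V × V)
      edgesM   : Edges M
      uniqueM  : Unique (verts M)
      lengthM  : length M ≡ k
      edgesN   : Edges N
      uniqueN  : Unique (verts N)
      lengthN  : length N ≡ k
      first∉M  : ∀ {x} → x ∈ map proj₁ N → x ∉ verts M

  opaque
    configuration : Configuration
    configuration
      -- The first `k` vertices are just some `k`-set to cover.
      with M , esM , uM , lenM , _ ← matchingCovering (Unique.take⁺ k (Unique.allFin⁺ n))
             (≡.trans (length-take k (allFin n))
               (≡.trans (cong (k ⊓_) (length-tabulate id)) (m≤n⇒m⊓n≡m k≤n)))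
      with X , uX , X∉M , lenX ← uncoveredSet M uM lenM
      -- `M` is maximum and misses `X`, so `X` is independent in `H` and the edges of `N` lead out
      -- of it.
      with N , esN , uN , lenN , X↭ , _ ← matchingFrom (λ x → x ∈? X)
             (λ a∈ b∈ → maximum⇒maximal esM uM lenM (X∉M a∈) (X∉M b∈)) uX lenX id
      = record
        { M = M ; N = N ; edgesM = esM ; uniqueM = uM ; lengthM = lenM
        ; edgesN = esN ; uniqueN = uN ; lengthN = lenN
        ; first∉M = λ x∈ → X∉M (∈-resp-↭ X↭ x∈)
        }

  open Configuration configuration

  X Q : List V
  X = map proj₁ N
  Q = map proj₂ N

  uniqueX++Q : Unique (X ++ Q)
  uniqueX++Q = Unique-resp-↭ (verts-split N) uniqueN

  uncovered : ∀ {v} → v ∉ X → v ∉ Q → v ∉ verts N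
  uncovered v∉X v∉Q v∈ = [ v∉X , v∉Q ]′ (∈-++⁻ X (∈-resp-↭ (verts-split N) v∈))

  opaque
    -- An edge `x v` would let a path of three edges augment `M` or `N`. Let `N` match `x` to `q`.
    -- Since `M` is maximal and misses `x`, it covers `q`, say by `q a`; whether `a` lies in `Q`
    -- decides which matching is augmented.
    nonedge-X : ∀ {x v} → x ∈ X → v ∉ X → v ∉ Q → ¬ Adj H x v
    nonedge-X {x} {v} x∈X v∉X v∉Q xv
      with (_ , q) , xq∈N , refl ← ∈-map⁻ proj₁ x∈X
      with N′ , xq , esN′ , pN , lenN ← partner₂ edgesN xq∈N
      with q ∈? verts M
    ... | no q∉M = maximum⇒maximal edgesM uniqueM lengthM (first∉M x∈X) q∉M xq
    ... | yes q∈M with a , M′ , qa , esM′ , pM , lenM ← partner M edgesM q∈M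
      with a ∈? Q
    -- The path is `v x q a`. As `M` covers `a`, it is not in `X`, so `N` misses it; and `v` equal
    -- to `a` would close a triangle with `x` and `q`.
    ... | no a∉Q = maximum N lengthN (swap-edge N esN′ uniqueN pN lenN xv qa
            (uncovered v∉X v∉Q)
            (uncovered (λ a∈X → first∉M a∈X (∈-resp-↭ (↭-sym pM) (there (here refl)))) a∉Q)
            (λ { refl → triangleFree xq xv qa }))
    -- `N` matches `a` to some `x′` in `X`, and the path is `x q a x′`, whose ends `M` misses. They
    -- differ, since otherwise `x`, `q` and `a` form a triangle.
    ... | yes a∈Q with (x′ , _) , x′a∈N , refl ← ∈-map⁻ proj₂ a∈Q =
      maximum M lengthM (swap-edge M esM′ uniqueM pM lenM (symm H xq) (symm H (All.lookup edgesN x′a∈N))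
        (first∉M x∈X) (first∉M (∈-map⁺ proj₁ x′a∈N))
        (λ { refl → triangleFree xq (All.lookup edgesN x′a∈N) qa }))

  -- `M` misses any two vertices in `X`, and `N` any two outside `X` and `Q`; only the mixed case
  -- takes the exchange argument.
  nonedge : ∀ {v w} → v ∉ Q → w ∉ Q → ¬ Adj H v w
  nonedge {v} {w} v∉Q w∉Q vw with v ∈? X | w ∈? X
  ... | yes v∈X | yes w∈X = maximum⇒maximal edgesM uniqueM lengthM (first∉M v∈X) (first∉M w∈X) vw
  ... | yes v∈X | no w∉X = nonedge-X v∈X w∉X w∉Q vw
  ... | no v∉X | yes w∈X = nonedge-X w∈X v∉X v∉Q (symm H vw)
  ... | no v∉X | no w∉X = maximum⇒maximal edgesN uniqueN lengthN (uncovered v∉X v∉Q) (uncovered w∉X w∉Q) vw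

  V₁ : Subset n
  V₁ = ∁ (fromList Q)

  V₁⇒∉Q : ∀ {v} → v Sub.∈ V₁ → v ∉ Q
  V₁⇒∉Q v∈ v∈Q = x∈∁p⇒x∉p v∈ (∈-fromList⁺ {xs = Q} v∈Q)

  ∣V₁∣ : ∣ V₁ ∣ ≡ n ∸ k
  ∣V₁∣ = ≡.trans (∣∁p∣≡n∸∣p∣ (fromList Q)) (cong (n ∸_)
    (≡.trans (∣fromList∣ {xs = Q} (unique-++⁻ʳ X uniqueX++Q)) (≡.trans (length-map proj₂ N) lengthN)))

  ∣∁V₁∣ : ∣ ∁ V₁ ∣ ≡ k
  ∣∁V₁∣ = ≡.trans (∣∁p∣≡n∸∣p∣ V₁) (≡.trans (cong (n ∸_) ∣V₁∣) (m∸[m∸n]≡n k≤n))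

  matchings : ∀ Y → Y Sub.⊆ V₁ → ∣ Y ∣ ≡ k → Matching H k Y (∁ V₁)
  matchings Y Y⊆V₁ lenY
    with L , es , u , len , L↭ , out ← matchingFrom (_∈ₛ? V₁)
           (λ a∈ b∈ → nonedge (V₁⇒∉Q a∈) (V₁⇒∉Q b∈)) (elems-unique Y)
           (≡.trans (length-elems Y) lenY) (Y⊆V₁ ∘ ∈-elems⁻)
    = subst (λ m → Matching H m Y (∁ V₁)) len (list⇒matching L es u λ ab∈ →
        ∈-elems⁻ (∈-resp-↭ L↭ (∈-map⁺ proj₁ ab∈)) , x∉p⇒x∈∁p (out (∈-map⁺ proj₂ ab∈)))

  -- The vertices outside the closed neighbourhood of `u` are its neighbours in `H`, so two that are
  -- nonadjacent in `G` would close a triangle there.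
  nonneighborsAdjacent : ∀ u → Complete (G [ ∁ (closedNeighborhood G u) ])
  nonneighborsAdjacent u (v , v∈) (w , w∈) v≢w =
    ¬E⇒Adj (∃∈-≢ v≢w) (triangleFree (nonneighbor v∈) (nonneighbor w∈))
    where
    nonneighbor : ∀ {x} → x Sub.∈ ∁ (closedNeighborhood G u) → Adj H u x
    nonneighbor x∈ =
      (λ u≡x → x∈∁p⇒x∉p x∈ (∈-tabulate⁺ (λ x → (u ≟ x) ⊎-dec adj? G u x) (inj₁ u≡x))) ,
      (λ ux → x∈∁p⇒x∉p x∈ (∈-tabulate⁺ (λ x → (u ≟ x) ⊎-dec adj? G u x) (inj₂ ux)))

  conclusion : ObtainedFromCliqueAndGraph G k
  conclusion = record
    { V₁ = V₁
    ; order-G₁ = ∣V₁∣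
    ; order-G₂ = ∣∁V₁∣
    ; clique-G₁ = λ (v , v∈) (w , w∈) v≢w → ¬E⇒Adj (∃∈-≢ v≢w) (nonedge (V₁⇒∉Q v∈) (V₁⇒∉Q w∈))
    ; nonneighbor = nonneighborsAdjacent
    ; matching = matchings
    }

theorem6 : ∀ (n k : ℕ) (G : Graph (Fin n)) → 2 ≤ k → 3 * k ≤ n → Connected G →
  WellHuedWithSequence G k ⇔ ObtainedFromCliqueAndGraph G k
theorem6 n k G 2≤k 3k≤n _ = mk⇔ (Necessity.conclusion G 2≤k 3k≤n) (Sufficiency.conclusion G 3k≤n)
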